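{- For every integer $p\ge 1$ and every integer $n\ge p+2$, $$\sigma(K_{p,1,1},n)\;\ge\; 2\left\lfloor \frac{(p+1)(n-1)+2}{2}\right\rfloor .$$
   Context: A finite sequence $S=(d_1,\dots,d_n)$ of non-negative integers is graphical if it is the degree sequence of some simple graph on $n$ vertices (a realization of $S$). Write $\sigma(S)=d_1+\dots+d_n$. For a graph $H$, a graphical sequence $S$ is potentially $H$-graphical if some realization of $S$ contains $H$ as a subgraph. $K_{p,1,1}$ denotes the complete 3-partite graph with parts of sizes $p,1,1$. $\sigma(H,n)$ denotes the minimum even integer $l$ such that every $n$-term graphical sequence $S$ with $\sigma(S)\ge l$ is potentially $H$-graphical. $\lfloor x\rfloor$ is the largest integer $\le x$. -}

module Defs where

open import Data.Bool.Base using (Bool; true; false; T; not)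
import Data.Bool.Properties as Bool
open import Data.Fin.Base using (Fin; zero; suc; splitAt)
import Data.Fin.Properties as Fin
open import Data.Fin.Subset using (Subset; ∣_∣)
open import Data.Fin.Subset.Properties using (anySubset?; ∣p∣≤n)
open import Data.Nat.Base using (ℕ; zero; suc; _+_; _*_; _≤_; z≤n; s≤s)
open import Data.Nat.Divisibility using (_∣_; _∣?_; m∣m*n)
import Data.Nat.Properties as ℕ
open import Data.Product.Base using (∃; Σ; _×_; _,_; proj₁; proj₂)
open import Data.Sum.Base using ([_,_])
open import Data.Vec.Base using (Vec; []; _∷_; lookup; tabulate; sum)
open import Data.Vec.Properties using (≡-dec; lookup∘tabulate; tabulate-cong)
open import Function.Base using (const; _∘_)
open import Function.Definitions using (Injective)
open import Relation.Binary.PropositionalEquality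
  using (_≡_; refl; sym; trans; cong; cong₂; subst)
open import Relation.Nullary using (¬_; Dec; yes; no; contradiction)
open import Relation.Nullary.Decidable
  using (map′; ⌊_⌋; _×-dec_; _→-dec_; ¬?; decidable-stable)
open import Relation.Unary using (Decidable)

private
  variable
    m n : ℕ

record Graph (n : ℕ) : Set where
  field
    adj     : Fin n → Fin n → Bool
    adj-sym : ∀ u v → adj u v ≡ adj v u
    irrefl  : ∀ v → adj v v ≡ false

  neighbours : Fin n → Subset n
  neighbours v = tabulate (adj v)

  degree : Fin n → ℕ
  degree v = ∣ neighbours v ∣

  degreeSequence : Vec ℕ n
  degreeSequence = tabulate degree

open Graph public

-- The subgraph need not be induced: non-edges of H may map to edges of G.
infix 4 _⊑_
_⊑_ : Graph m → Graph n → Set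
_⊑_ {m} {n} H G = Σ (Fin m → Fin n) λ f →
  Injective _≡_ _≡_ f × (∀ u v → T (adj H u v) → T (adj G (f u) (f v)))

completeMultipartite : ∀ {k} → (Fin n → Fin k) → Graph n
completeMultipartite part = record
  { adj     = λ u v → not ⌊ part u Fin.≟ part v ⌋
  ; adj-sym = λ u v → cong not (≟-sym (part u) (part v))
  ; irrefl  = λ v → cong not (≟-refl (part v))
  }
  where
  ≟-sym : ∀ {k} (i j : Fin k) → ⌊ i Fin.≟ j ⌋ ≡ ⌊ j Fin.≟ i ⌋
  ≟-sym i j with i Fin.≟ j | j Fin.≟ i
  ... | yes _ | yes _ = refl
  ... | yes p | no ¬q = contradiction (sym p) ¬q
  ... | no ¬p | yes q = contradiction (sym q) ¬p
  ... | no _  | no _  = refl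

  ≟-refl : ∀ {k} (i : Fin k) → ⌊ i Fin.≟ i ⌋ ≡ true
  ≟-refl i with i Fin.≟ i
  ... | yes _ = refl
  ... | no ¬p = contradiction refl ¬p

K : ∀ p q r → Graph (p + (q + r))
K p q r = completeMultipartite part
  where
  part : Fin (p + (q + r)) → Fin 3
  part v = [ const zero
           , [ const (suc zero) , const (suc (suc zero)) ] ∘ splitAt q
           ] (splitAt p v)

Realizes : Graph n → Vec ℕ n → Set
Realizes G S = degreeSequence G ≡ S

Graphical : Vec ℕ n → Set
Graphical S = ∃ λ G → Realizes G S

PotentiallyGraphical : Graph m → Vec ℕ n → Set
PotentiallyGraphical H S = ∃ λ G → Realizes G S × H ⊑ G

IsThreshold : Graph m → ℕ → ℕ → Set
IsThreshold H n l =
  2 ∣ l × (∀ (S : Vec ℕ n) → Graphical S → l ≤ sum S → PotentiallyGraphical H S)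

IsLeast : (ℕ → Set) → ℕ → Set
IsLeast P l = P l × (∀ k → P k → l ≤ k)

-- The least threshold exists: being a threshold is decidable by finite
-- search, and any even number above n * n is one vacuously.

private
  anyVec? : ∀ {A : Set} →
            (∀ {P : A → Set} → Decidable P → Dec (∃ P)) →
            ∀ n {P : Vec A n → Set} → Decidable P → Dec (∃ P)
  anyVec? any zero    P? = map′ ([] ,_) (λ { ([] , p) → p }) (P? [])
  anyVec? any (suc n) P? = map′
    (λ { (x , xs , p) → x ∷ xs , p })
    (λ { (x ∷ xs , p) → x , xs , p })
    (any λ x → anyVec? any n λ xs → P? (x ∷ xs))

  _≈_ : Graph n → Graph n → Set
  G ≈ G′ = ∀ u v → adj G u v ≡ adj G′ u v

  anyGraph? : {P : Graph n → Set} → (∀ {G G′} → G ≈ G′ → P G → P G′) →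
              Decidable P → Dec (∃ P)
  anyGraph? {n} {P} resp P? = map′
    (λ { (M , ok , p) → toGraph M ok , p })
    (λ { (G , p) → fromGraph G p })
    (anyVec? anySubset? n Q?)
    where
    entry : Vec (Subset n) n → Fin n → Fin n → Bool
    entry M u v = lookup (lookup M u) v

    IsGraph : Vec (Subset n) n → Set
    IsGraph M = (∀ u v → entry M u v ≡ entry M v u) × (∀ v → entry M v v ≡ false)

    isGraph? : Decidable IsGraph
    isGraph? M =
      Fin.all? (λ u → Fin.all? λ v → entry M u v Bool.≟ entry M v u) ×-dec
      Fin.all? (λ v → entry M v v Bool.≟ false)

    toGraph : ∀ M → IsGraph M → Graph n
    toGraph M (s , i) = record { adj = entry M ; adj-sym = s ; irrefl = i }

    Q : Vec (Subset n) n → Set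
    Q M = Σ (IsGraph M) λ ok → P (toGraph M ok)

    Q? : Decidable Q
    Q? M with isGraph? M
    ... | no ¬ok = no (¬ok ∘ proj₁)
    ... | yes ok = map′ (ok ,_) (λ { (_ , p) → resp (λ _ _ → refl) p })
                        (P? (toGraph M ok))

    fromGraph : ∀ G → P G → ∃ Q
    fromGraph G p = M , ok , resp (λ u v → sym (eq u v)) p
      where
      M = tabulate (neighbours G)

      eq : ∀ u v → entry M u v ≡ adj G u v
      eq u v = trans (cong (λ N → lookup N v) (lookup∘tabulate (neighbours G) u))
                     (lookup∘tabulate (adj G u) v)

      ok : IsGraph M
      ok = (λ u v → trans (eq u v) (trans (adj-sym G u v) (sym (eq v u))))
         , (λ v → trans (eq v v) (irrefl G v))

  degreeSequence-cong : ∀ {G G′ : Graph n} → G ≈ G′ →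
                        degreeSequence G ≡ degreeSequence G′
  degreeSequence-cong G≈G′ = tabulate-cong λ v → cong ∣_∣ (tabulate-cong (G≈G′ v))

  ⊑-resp : ∀ {H : Graph m} {G G′ : Graph n} → G ≈ G′ → H ⊑ G → H ⊑ G′
  ⊑-resp G≈G′ (f , inj , hom) =
    f , inj , λ u v e → subst T (G≈G′ (f u) (f v)) (hom u v e)

  _⊑?_ : ∀ (H : Graph m) (G : Graph n) → Dec (H ⊑ G)
  _⊑?_ {m} {n} H G = map′
    (λ { (xs , inj , hom) → lookup xs , (λ {u} {v} → inj u v) , hom })
    (λ { (f , inj , hom) → fromFun f inj hom })
    (anyVec? Fin.any? m λ xs →
      Fin.all? (λ u → Fin.all? λ v →
        (lookup xs u Fin.≟ lookup xs v) →-dec (u Fin.≟ v)) ×-dec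
      Fin.all? (λ u → Fin.all? λ v →
        Bool.T? (adj H u v) →-dec Bool.T? (adj G (lookup xs u) (lookup xs v))))
    where
    fromFun : (f : Fin m → Fin n) → Injective _≡_ _≡_ f →
              (∀ u v → T (adj H u v) → T (adj G (f u) (f v))) →
              ∃ λ xs → (∀ u v → lookup xs u ≡ lookup xs v → u ≡ v) ×
                (∀ u v → T (adj H u v) → T (adj G (lookup xs u) (lookup xs v)))
    fromFun f inj hom = tabulate f
      , (λ u v e → inj (trans (sym (eq u)) (trans e (eq v))))
      , (λ u v e → subst T (sym (cong₂ (adj G) (eq u) (eq v))) (hom u v e))
      where
      eq = lookup∘tabulate f

  potentiallyGraphical? : ∀ (H : Graph m) (S : Vec ℕ n) →
                          Dec (PotentiallyGraphical H S)
  potentiallyGraphical? H S = anyGraph?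
    (λ {G} {G′} e (r , c) →
      trans (sym (degreeSequence-cong {G = G} {G′} e)) r
      , ⊑-resp {H = H} {G} {G′} e c)
    (λ G → ≡-dec ℕ._≟_ (degreeSequence G) S ×-dec (H ⊑? G))

  isThreshold? : ∀ (H : Graph m) n → Decidable (IsThreshold H n)
  isThreshold? H n l = (2 ∣? l) ×-dec map′
    (λ { ¬bad _ (G , refl) l≤ → decidable-stable (potentiallyGraphical? H _)
           λ ¬pot → ¬bad (G , l≤ , ¬pot) })
    (λ { all (G , l≤ , ¬pot) → ¬pot (all _ (G , refl) l≤) })
    (¬? (anyGraph? {P = Bad}
      (λ {G} {G′} e → subst (λ S → l ≤ sum S × ¬ PotentiallyGraphical H S)
                            (degreeSequence-cong {G = G} {G′} e))
      (λ G → (l ℕ.≤? _) ×-dec ¬? (potentiallyGraphical? H _))))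
    where
    Bad : Graph n → Set
    Bad G = l ≤ sum (degreeSequence G) × ¬ PotentiallyGraphical H (degreeSequence G)

  sum-tabulate-≤ : ∀ {k} (f : Fin n → ℕ) → (∀ i → f i ≤ k) →
                   sum (tabulate f) ≤ n * k
  sum-tabulate-≤ {zero}  f f≤k = z≤n
  sum-tabulate-≤ {suc n} f f≤k =
    ℕ.+-mono-≤ (f≤k zero) (sum-tabulate-≤ (f ∘ suc) (f≤k ∘ suc))

  largeThreshold : ∀ (H : Graph m) n → IsThreshold H n (2 * suc (n * n))
  largeThreshold H n = m∣m*n (suc (n * n)) , λ { _ (G , refl) l≤ →
    contradiction
      (ℕ.≤-trans (ℕ.m≤m+n (suc (n * n)) _)
        (ℕ.≤-trans l≤ (sum-tabulate-≤ (degree G) λ v → ∣p∣≤n (neighbours G v))))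
      ℕ.1+n≰n }

  least : ∀ {P : ℕ → Set} → Decidable P → ∀ k → P k → ∃ (IsLeast P)
  least P? zero    p = zero , p , λ _ _ → z≤n
  least {P} P? (suc k) p with P? zero
  ... | yes p₀ = zero , p₀ , λ _ _ → z≤n
  ... | no ¬p₀ with l , q , min ← least (P? ∘ suc) k p = suc l , q , min′
    where
    min′ : ∀ j → P j → suc l ≤ j
    min′ zero    p₀ = contradiction p₀ ¬p₀
    min′ (suc j) pⱼ = s≤s (min j pⱼ)

abstract
  leastThreshold : ∀ (H : Graph m) n → ∃ (IsLeast (IsThreshold H n))
  leastThreshold H n = least (isThreshold? H n) _ (largeThreshold H n)

σ : Graph m → ℕ → ℕ
σ H n = proj₁ (leastThreshold H n)

σ-isLeast : ∀ (H : Graph m) n → IsLeast (IsThreshold H n) (σ H n)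
σ-isLeast H n = proj₂ (leastThreshold H n)

{-# OPTIONS --safe #-}
module Submission where

-- K_{p,1,1} has two vertices of degree p + 1, so a graph with a single vertex of degree
-- above p does not contain it, and this depends only on the degree sequence.  Joining a
-- hub to a graph on m = n - 1 vertices with all degrees at most k = p - 1 and degree sum
-- at least 2⌊km/2⌋ gives such a graph of degree sum at least 2⌊(p+1)m/2⌋; an even
-- threshold must exceed that by 2.
-- The graph on m vertices is a circulant whose distances fill an interval [a , m - a];
-- it is (m + 1 - 2a)-regular, which is k when k and m have opposite parity.  For equal
-- parity take a (k - 1)-regular one, where a ≥ 2 leaves distance 1 free for the
-- matching {0,1}, {2,3}, ….

open import Defs using (σ; K)
open import Data.Nat using (ℕ; _+_; _*_; _∸_; _≥_)
open import Data.Nat.DivMod using (_/_)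

open import Data.Bool.Base using (Bool; true; false; T; _∧_; _∨_)
open import Data.Bool.Properties using (T-≡; ∧-zeroʳ; ∧-comm)
open import Data.Fin.Base using (Fin; zero; suc; toℕ; punchIn; splitAt; _↑ʳ_)
open import Data.Fin.Properties
  using (toℕ<n; suc-injective; punchIn-injective; punchInᵢ≢i; splitAt-↑ʳ; splitAt⁻¹-↑ʳ; ↑ʳ-injective)
open import Data.Fin.Subset using (Subset; ∣_∣; _∈_) renaming (_-_ to _∖_)
open import Data.Fin.Subset.Properties using (x∈p⇒∣p-x∣<∣p∣; x∈p∧x≢y⇒x∈p-y)
open import Data.Nat.Base
  using (zero; suc; _≤_; _<_; _≤ᵇ_; ∣_-_∣; ⌊_/2⌋; z≤n; s≤s)
open import Data.Nat.Divisibility using (divides; n∣m*n)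
open import Data.Nat.DivMod using (m*n/n≡m; m/n*n≤m; +-distrib-/-∣ˡ)
open import Data.Nat.Properties hiding (suc-injective)
open import Data.Nat.Tactic.RingSolver using (solve-∀)
open import Data.Product.Base using (∃; _×_; _,_)
open import Data.Sum.Base using (_⊎_; inj₁; inj₂)
open import Data.Vec.Base using (tabulate; sum; lookup)
open import Data.Vec.Properties using (lookup∘tabulate; lookup⇒[]=; tabulate-cong)
open import Function.Base using (_∘_)
open import Function.Bundles using (Equivalence)
open import Function.Definitions using (Injective)
open import Relation.Binary.PropositionalEquality
  using (_≡_; _≢_; refl; sym; trans; cong; cong₂; subst; module ≡-Reasoning)
open import Relation.Nullary using (¬_)
open import Relation.Nullary.Decidable using (dec-true; dec-false)

open Defs using
  (Graph; adj; adj-sym; irrefl; neighbours; degree; degreeSequence; _⊑_; σ-isLeast; IsThreshold)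

-- Finite sums and counting

bit : Bool → ℕ
bit true  = 1
bit false = 0

∑ : ℕ → (ℕ → ℕ) → ℕ
∑ zero    f = 0
∑ (suc n) f = f 0 + ∑ n (f ∘ suc)

∑-cong : ∀ n {f g} → (∀ i → i < n → f i ≡ g i) → ∑ n f ≡ ∑ n g
∑-cong zero    f≗g = refl
∑-cong (suc n) f≗g =
  cong₂ _+_ (f≗g 0 (s≤s z≤n)) (∑-cong n λ i i<n → f≗g (suc i) (s≤s i<n))

∑-const : ∀ n {f} c → (∀ i → i < n → f i ≡ c) → ∑ n f ≡ n * c
∑-const zero    c f≡c = refl
∑-const (suc n) c f≡c =
  cong₂ _+_ (f≡c 0 (s≤s z≤n)) (∑-const n c λ i i<n → f≡c (suc i) (s≤s i<n))

∑-split : ∀ m n f → ∑ (m + n) f ≡ ∑ m f + ∑ n (f ∘ (m +_))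
∑-split zero    n f = refl
∑-split (suc m) n f =
  trans (cong (f 0 +_) (∑-split m n (f ∘ suc))) (sym (+-assoc (f 0) _ _))

∑-distrib-+ : ∀ n f g → ∑ n (λ i → f i + g i) ≡ ∑ n f + ∑ n g
∑-distrib-+ zero    f g = refl
∑-distrib-+ (suc n) f g =
  trans (cong (f 0 + g 0 +_) (∑-distrib-+ n (f ∘ suc) (g ∘ suc)))
        (interchange (f 0) (g 0) _ _)
  where
  interchange : ∀ a b c d → (a + b) + (c + d) ≡ (a + c) + (b + d)
  interchange = solve-∀

sum-tabulate-toℕ : ∀ n f → sum (tabulate {n = n} (f ∘ toℕ)) ≡ ∑ n f
sum-tabulate-toℕ zero    f = refl
sum-tabulate-toℕ (suc n) f = cong (f 0 +_) (sum-tabulate-toℕ n (f ∘ suc))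

sum-tabulate-suc : ∀ {n} (f : Fin n → ℕ) → sum (tabulate (suc ∘ f)) ≡ n + sum (tabulate f)
sum-tabulate-suc {zero}  f = refl
sum-tabulate-suc {suc n} f =
  cong suc (trans (cong (f zero +_) (sum-tabulate-suc (f ∘ suc))) (swap (f zero) n _))
  where
  swap : ∀ a b c → a + (b + c) ≡ b + (a + c)
  swap = solve-∀

∣tabulate-toℕ∣ : ∀ n (b : ℕ → Bool) → ∣ tabulate {n = n} (b ∘ toℕ) ∣ ≡ ∑ n (bit ∘ b)
∣tabulate-toℕ∣ zero    b = refl
∣tabulate-toℕ∣ (suc n) b with b 0
... | true  = cong suc (∣tabulate-toℕ∣ n (b ∘ suc))
... | false = ∣tabulate-toℕ∣ n (b ∘ suc)

∣tabulate-true∣ : ∀ n → ∣ tabulate {n = n} (λ _ → true) ∣ ≡ n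
∣tabulate-true∣ zero    = refl
∣tabulate-true∣ (suc n) = cong suc (∣tabulate-true∣ n)

-- Relations on the natural numbers and their restrictions to graphs

-- Living on all of ℕ, relations have row sums that can be split and reindexed by plain arithmetic,
-- without `Fin`.
record Relation : Set where
  field
    related        : ℕ → ℕ → Bool
    related-sym    : ∀ u v → related u v ≡ related v u
    related-irrefl : ∀ v → related v v ≡ false

  rowSum : ℕ → ℕ → ℕ
  rowSum n u = ∑ n (bit ∘ related u)

open Relation

restrict : Relation → ∀ n → Graph n
restrict R n = record
  { adj     = λ u v → related R (toℕ u) (toℕ v)
  ; adj-sym = λ u v → related-sym R (toℕ u) (toℕ v)
  ; irrefl  = λ v → related-irrefl R (toℕ v)
  }

degree-restrict : ∀ R n v → degree (restrict R n) v ≡ rowSum R n (toℕ v)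
degree-restrict R n v = ∣tabulate-toℕ∣ n (related R (toℕ v))

sum-degree-restrict : ∀ R n → sum (degreeSequence (restrict R n)) ≡ ∑ n (rowSum R n)
sum-degree-restrict R n =
  trans (cong sum (tabulate-cong (degree-restrict R n))) (sum-tabulate-toℕ n (rowSum R n))

_∪_ : Relation → Relation → Relation
R ∪ Q = record
  { related        = λ u v → related R u v ∨ related Q u v
  ; related-sym    = λ u v → cong₂ _∨_ (related-sym R u v) (related-sym Q u v)
  ; related-irrefl = λ v → cong₂ _∨_ (related-irrefl R v) (related-irrefl Q v)
  }

rowSum-∪ : ∀ R Q → (∀ u v → related Q u v ≡ true → related R u v ≡ false) →
           ∀ n u → rowSum (R ∪ Q) n u ≡ rowSum R n u + rowSum Q n u
rowSum-∪ R Q disjoint n u =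
  trans (∑-cong n λ v _ → bit-∨ (related R u v) (related Q u v) (disjoint u v))
        (∑-distrib-+ n _ _)
  where
  bit-∨ : ∀ a b → (b ≡ true → a ≡ false) → bit (a ∨ b) ≡ bit a + bit b
  bit-∨ false b     _ = refl
  bit-∨ true  false _ = refl
  bit-∨ true  true  d with () ← d refl

empty : Relation
empty = record
  { related = λ _ _ → false ; related-sym = λ _ _ → refl ; related-irrefl = λ _ → refl }

-- The matching {0,1}, {2,3}, ...

-- Recursion in steps of two lets sums over `suc (suc n)` reduce to sums over `n` by computation.
mate : ℕ → ℕ → Bool
mate 0             1             = true
mate 1             0             = true
mate (suc (suc u)) (suc (suc v)) = mate u v
mate _             _             = false

matching : Relation
matching = record
  { related = mate ; related-sym = mate-sym ; related-irrefl = mate-irrefl }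
  where
  mate-sym : ∀ u v → mate u v ≡ mate v u
  mate-sym 0             0             = refl
  mate-sym 0             1             = refl
  mate-sym 0             (suc (suc v)) = refl
  mate-sym 1             0             = refl
  mate-sym 1             1             = refl
  mate-sym 1             (suc (suc v)) = refl
  mate-sym (suc (suc u)) 0             = refl
  mate-sym (suc (suc u)) 1             = refl
  mate-sym (suc (suc u)) (suc (suc v)) = mate-sym u v

  mate-irrefl : ∀ v → mate v v ≡ false
  mate-irrefl 0             = refl
  mate-irrefl 1             = refl
  mate-irrefl (suc (suc v)) = mate-irrefl v

mate⇒∣-∣≡1 : ∀ u v → mate u v ≡ true → ∣ u - v ∣ ≡ 1
mate⇒∣-∣≡1 0             1             _ = refl
mate⇒∣-∣≡1 1             0             _ = refl
mate⇒∣-∣≡1 (suc (suc u)) (suc (suc v)) e = mate⇒∣-∣≡1 u v e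

∑-zero : ∀ n → ∑ n (λ _ → 0) ≡ 0
∑-zero n = trans (∑-const n 0 λ _ _ → refl) (*-zeroʳ n)

rowSum-matching≤1 : ∀ n u → rowSum matching n u ≤ 1
rowSum-matching≤1 0             u             = z≤n
rowSum-matching≤1 1             0             = z≤n
rowSum-matching≤1 1             1             = ≤-refl
rowSum-matching≤1 1             (suc (suc u)) = z≤n
rowSum-matching≤1 (suc (suc n)) 0             = ≤-reflexive (cong suc (∑-zero n))
rowSum-matching≤1 (suc (suc n)) 1             = ≤-reflexive (cong suc (∑-zero n))
rowSum-matching≤1 (suc (suc n)) (suc (suc u)) = rowSum-matching≤1 n u

-- For odd `n` the partner of `n - 1` falls outside the range, which leaves ⌊n/2⌋ pairs, each
-- counted from both ends.
∑-rowSum-matching : ∀ n → ∑ n (rowSum matching n) ≡ ⌊ n /2⌋ * 2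
∑-rowSum-matching 0             = refl
∑-rowSum-matching 1             = refl
∑-rowSum-matching (suc (suc n)) =
  cong₂ _+_ (cong suc (∑-zero n))
    (cong₂ _+_ (cong suc (∑-zero n)) (∑-rowSum-matching n))

-- Circulants

-- The interval [1 + a , n - (1 + a)], so this a is one less than the a of the introduction.
window : ℕ → ℕ → ℕ → Bool
window a n d = (suc a ≤ᵇ d) ∧ (suc a ≤ᵇ n ∸ d)

circulant : ℕ → ℕ → Relation
circulant a n = record
  { related        = λ u v → window a n ∣ u - v ∣
  ; related-sym    = λ u v → cong (window a n) (∣-∣-comm u v)
  ; related-irrefl = λ v → cong (window a n) (∣n-n∣≡0 v)
  }

window-sym : ∀ a n d → d ≤ n → window a n d ≡ window a n (n ∸ d)
window-sym a n d d≤n =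
  trans (∧-comm (suc a ≤ᵇ d) _) (cong (λ x → (suc a ≤ᵇ n ∸ d) ∧ (suc a ≤ᵇ x)) (sym (m∸[m∸n]≡n d≤n)))

-- With n = u + r, the vertices from `u` on lie at distances 0, ..., r - 1. Those below lie at
-- distances u, ..., 1, which the symmetry d ↦ n - d turns into r, ..., n - 1. Each argument below
-- `n` thus occurs once.
∑-∣-∣ : ∀ n (f : ℕ → ℕ) → (∀ d → d ≤ n → f d ≡ f (n ∸ d)) →
        ∀ u → u < n → ∑ n (λ v → f ∣ u - v ∣) ≡ ∑ n f
∑-∣-∣ n f f-sym u u<n with r , refl ← m≤n⇒∃[o]m+o≡n (<⇒≤ u<n) = begin
  ∑ (u + r) (λ v → f ∣ u - v ∣)
    ≡⟨ ∑-split u r _ ⟩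
  ∑ u (λ v → f ∣ u - v ∣) + ∑ r (λ i → f ∣ u - u + i ∣)
    ≡⟨ cong₂ _+_ (∑-cong u below) (∑-cong r λ i _ → cong f (∣m-m+n∣≡n u i)) ⟩
  ∑ u (f ∘ (r +_)) + ∑ r f
    ≡⟨ +-comm _ (∑ r f) ⟩
  ∑ r f + ∑ u (f ∘ (r +_))
    ≡⟨ ∑-split r u f ⟨
  ∑ (r + u) f
    ≡⟨ cong (λ k → ∑ k f) (+-comm r u) ⟩
  ∑ (u + r) f ∎
  where
  open ≡-Reasoning
  below : ∀ v → v < u → f ∣ u - v ∣ ≡ f (r + v)
  below v v<u with o , refl ← m≤n⇒∃[o]m+o≡n (<⇒≤ v<u) = begin
    f ∣ v + o - v ∣       ≡⟨ cong f (trans (∣-∣-comm (v + o) v) (∣m-m+n∣≡n v o)) ⟩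
    f o                   ≡⟨ f-sym o (≤-trans (m≤n+m o v) (m≤m+n (v + o) r)) ⟩
    f (v + o + r ∸ o)     ≡⟨ cong (λ x → f (x ∸ o)) (rearrange v o r) ⟩
    f (r + v + o ∸ o)     ≡⟨ cong f (m+n∸n≡m (r + v) o) ⟩
    f (r + v)             ∎
    where
    rearrange : ∀ v o r → v + o + r ≡ r + v + o
    rearrange = solve-∀

-- The form of `n` lists three blocks of distances: `suc a` below the window, `w` inside it and `a`
-- above it.
∑-window : ∀ a w → let n = suc a + (w + a) in ∑ n (bit ∘ window a n) ≡ w
∑-window a w = begin
  ∑ n f
    ≡⟨ ∑-split (suc a) (w + a) f ⟩
  ∑ (suc a) f + ∑ (w + a) (f ∘ (suc a +_))
    ≡⟨ cong (∑ (suc a) f +_) (∑-split w a (f ∘ (suc a +_))) ⟩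
  ∑ (suc a) f + (∑ w (f ∘ (suc a +_)) + ∑ a (f ∘ (suc a +_) ∘ (w +_)))
    ≡⟨ cong₂ _+_ (∑-const (suc a) 0 low) (cong₂ _+_ (∑-const w 1 middle) (∑-const a 0 high)) ⟩
  suc a * 0 + (w * 1 + a * 0)
    ≡⟨ collapse a w ⟩
  w ∎
  where
  open ≡-Reasoning
  n : ℕ
  n = suc a + (w + a)
  f = bit ∘ window a n

  collapse : ∀ a w → (1 + a) * 0 + (w * 1 + a * 0) ≡ w
  collapse = solve-∀

  low : ∀ d → d < suc a → f d ≡ 0
  low d d<1+a = cong (λ b → bit (b ∧ (suc a ≤ᵇ n ∸ d))) (dec-false (suc a ≤? d) (<⇒≱ d<1+a))

  middle : ∀ i → i < w → f (suc a + i) ≡ 1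
  middle i i<w = cong₂ (λ b c → bit (b ∧ c))
    (dec-true (suc a ≤? suc a + i) (m≤m+n (suc a) i))
    (dec-true (suc a ≤? n ∸ (suc a + i))
      (subst (suc a ≤_) (sym ([m+n]∸[m+o]≡n∸o (suc a) (w + a) i))
        (m+n≤o⇒m≤o∸n (suc a) (subst (_≤ w + a) (cong suc (+-comm i a)) (+-monoˡ-≤ a i<w)))))

  high : ∀ i → i < a → f (suc a + (w + i)) ≡ 0
  high i i<a = cong bit (trans
    (cong ((suc a ≤ᵇ suc a + (w + i)) ∧_) (dec-false (suc a ≤? n ∸ (suc a + (w + i))) λ le →
      <⇒≱ (s≤s (≤-trans (≤-reflexive eq) (m∸n≤m a i))) le))
    (∧-zeroʳ _))
    where
    eq : n ∸ (suc a + (w + i)) ≡ a ∸ i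
    eq = trans ([m+n]∸[m+o]≡n∸o (suc a) (w + a) (w + i)) ([m+n]∸[m+o]≡n∸o w a i)


rowSum-circulant : ∀ a w u → let n = suc a + (w + a) in u < n →
                   rowSum (circulant a n) n u ≡ w
rowSum-circulant a w u u<n =
  trans (∑-∣-∣ n (bit ∘ window a n) (λ d d≤n → cong bit (window-sym a n d d≤n)) u u<n)
        (∑-window a w)
  where
  n : ℕ
  n = suc a + (w + a)

-- Near-regular graphs of prescribed degree

parity : ∀ n → ∃ λ r → n ≡ r + r ⊎ n ≡ suc (r + r)
parity zero    = 0 , inj₁ refl
parity (suc n) with parity n
... | r , inj₁ refl = r , inj₂ refl
... | r , inj₂ refl = suc r , inj₁ (cong suc (sym (+-suc r r)))

⌊n/2⌋≡n/2 : ∀ n → ⌊ n /2⌋ ≡ n / 2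
⌊n/2⌋≡n/2 0             = refl
⌊n/2⌋≡n/2 1             = refl
⌊n/2⌋≡n/2 (suc (suc n)) =
  trans (cong suc (⌊n/2⌋≡n/2 n)) (sym (+-distrib-/-∣ˡ {2} n {2} (divides 1 refl)))

-- Rounding k * n down to an even number leaves room for the single deficient vertex
-- that is unavoidable when k and n are both odd.
NearRegular : ℕ → ℕ → Set
NearRegular k n = ∃ λ R →
  (∀ u → u < n → rowSum R n u ≤ k) × (k * n) / 2 * 2 ≤ ∑ n (rowSum R n)

empty-nearRegular : ∀ n → NearRegular 0 n
empty-nearRegular n = empty , (λ _ _ → ≤-reflexive (∑-zero n)) , z≤n

-- The order is 2a + w + 1, of parity opposite to `w`; the graph is exactly `w`-regular.
circulant-nearRegular : ∀ a w → NearRegular w (suc a + (w + a))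
circulant-nearRegular a w = circulant a n
  , (λ u u<n → ≤-reflexive (rowSum-circulant a w u u<n))
  , (begin
      (w * n) / 2 * 2               ≤⟨ m/n*n≤m (w * n) 2 ⟩
      w * n                         ≡⟨ *-comm w n ⟩
      n * w                         ≡⟨ ∑-const n w (rowSum-circulant a w) ⟨
      ∑ n (rowSum (circulant a n) n) ∎)
  where
  open ≤-Reasoning
  n : ℕ
  n = suc a + (w + a)

-- The order is 2a + w + 3, of the same parity as the degree bound `suc w`. The circulant supplies
-- degree `w` and the matching at most one more.
circulant∪matching-nearRegular : ∀ a w → let n = suc (suc a) + (w + suc a) in
                                 NearRegular (suc w) n
circulant∪matching-nearRegular a w = circulant (suc a) n ∪ matching
  , (λ u u<n → ≤-trans (≤-reflexive (row u u<n))
      (≤-trans (+-monoʳ-≤ w (rowSum-matching≤1 n u)) (≤-reflexive (+-comm w 1))))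
  , (begin
      (suc w * n) / 2 * 2                          ≤⟨ bound (parity w) ⟩
      n * w + ⌊ n /2⌋ * 2                          ≡⟨ total ⟨
      ∑ n (rowSum (circulant (suc a) n ∪ matching) n) ∎)
  where
  open ≤-Reasoning
  n : ℕ
  n = suc (suc a) + (w + suc a)

  disjoint : ∀ u v → mate u v ≡ true → window (suc a) n ∣ u - v ∣ ≡ false
  -- The window starts at 2 + a, so it rejects distance 1 by computation.
  disjoint u v e = cong (window (suc a) n) (mate⇒∣-∣≡1 u v e)

  row : ∀ u → u < n → rowSum (circulant (suc a) n ∪ matching) n u ≡ w + rowSum matching n u
  row u u<n = trans (rowSum-∪ (circulant (suc a) n) matching disjoint n u)
                    (cong (_+ rowSum matching n u) (rowSum-circulant (suc a) w u u<n))

  total : ∑ n (rowSum (circulant (suc a) n ∪ matching) n) ≡ n * w + ⌊ n /2⌋ * 2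
  total = trans (∑-cong n row)
    (trans (∑-distrib-+ n (λ _ → w) (rowSum matching n))
           (cong₂ _+_ (∑-const n w λ _ _ → refl) (∑-rowSum-matching n)))

  bound : (∃ λ r → w ≡ r + r ⊎ w ≡ suc (r + r)) →
          (suc w * n) / 2 * 2 ≤ n * w + ⌊ n /2⌋ * 2
  -- For even `w` the order is odd: the matching misses one vertex, which is exactly the loss from
  -- rounding.
  bound (r , inj₁ refl) = ≤-reflexive (begin-equality
    (suc (r + r) * n) / 2 * 2       ≡⟨ cong (λ x → x / 2 * 2) (separate r n) ⟩
    ((n * r) * 2 + n) / 2 * 2       ≡⟨ cong (_* 2) (+-distrib-/-∣ˡ n (n∣m*n (n * r))) ⟩
    ((n * r) * 2 / 2 + n / 2) * 2   ≡⟨ cong₂ (λ x y → (x + y) * 2) (m*n/n≡m (n * r) 2) (sym (⌊n/2⌋≡n/2 n)) ⟩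
    (n * r + ⌊ n /2⌋) * 2           ≡⟨ distribute r n ⌊ n /2⌋ ⟩
    n * (r + r) + ⌊ n /2⌋ * 2       ∎)
    where
    separate : ∀ r n → suc (r + r) * n ≡ (n * r) * 2 + n
    separate = solve-∀
    distribute : ∀ r n h → (n * r + h) * 2 ≡ n * (r + r) + h * 2
    distribute = solve-∀
  -- For odd `w` the order is even, so the matching is perfect and nothing is lost.
  bound (r , inj₂ refl) = begin
    (suc (suc (r + r)) * n) / 2 * 2      ≤⟨ m/n*n≤m (suc (suc (r + r)) * n) 2 ⟩
    suc (suc (r + r)) * n                ≡⟨ separate r n ⟩
    n * suc (r + r) + n                  ≡⟨ cong (n * suc (r + r) +_) n-even ⟨
    n * suc (r + r) + ⌊ n /2⌋ * 2        ∎
    where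
    separate : ∀ r n → suc (suc (r + r)) * n ≡ n * suc (r + r) + n
    separate = solve-∀
    double : ∀ a r → suc (suc a) + (suc (r + r) + suc a) ≡ (2 + a + r) * 2
    double = solve-∀
    n-even : ⌊ n /2⌋ * 2 ≡ n
    n-even = begin-equality
      ⌊ n /2⌋ * 2                  ≡⟨ cong (_* 2) (⌊n/2⌋≡n/2 n) ⟩
      n / 2 * 2                    ≡⟨ cong (λ x → x / 2 * 2) (double a r) ⟩
      (2 + a + r) * 2 / 2 * 2      ≡⟨ cong (_* 2) (m*n/n≡m (2 + a + r) 2) ⟩
      (2 + a + r) * 2              ≡⟨ double a r ⟨
      n                            ∎

-- For degree `suc k`, write n = 3 + k + e. Then `e` is even exactly when `n` and `suc k` have the
-- same parity, which selects the construction; e = 0 is the smallest order that the matched one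
-- attains.
nearRegular : ∀ k n → 2 + k ≤ n → NearRegular k n
nearRegular zero    n _ = empty-nearRegular n
nearRegular (suc k) n 3+k≤n with m≤n⇒∃[o]m+o≡n 3+k≤n
... | e , refl with parity e
...   | r , inj₁ refl = subst (NearRegular (suc k)) (size k r) (circulant∪matching-nearRegular r k)
  where
  size : ∀ k r → suc (suc r) + (k + suc r) ≡ 3 + k + (r + r)
  size = solve-∀
...   | r , inj₂ refl = subst (NearRegular (suc k)) (size k r) (circulant-nearRegular (suc r) (suc k))
  where
  size : ∀ k r → suc (suc r) + (suc k + suc r) ≡ 3 + k + suc (r + r)
  size = solve-∀

-- Joining a hub

cone : ∀ {n} → Graph n → Graph (suc n)
cone {n} G = record { adj = a ; adj-sym = a-sym ; irrefl = a-irrefl }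
  where
  a : Fin (suc n) → Fin (suc n) → Bool
  a zero    zero    = false
  a zero    (suc v) = true
  a (suc u) zero    = true
  a (suc u) (suc v) = adj G u v

  a-sym : ∀ u v → a u v ≡ a v u
  a-sym zero    zero    = refl
  a-sym zero    (suc v) = refl
  a-sym (suc u) zero    = refl
  a-sym (suc u) (suc v) = adj-sym G u v

  a-irrefl : ∀ v → a v v ≡ false
  a-irrefl zero    = refl
  a-irrefl (suc v) = irrefl G v

-- The first `n` is the degree of the hub, the second the new edge at each old vertex.
sum-degree-cone : ∀ {n} (G : Graph n) →
                  sum (degreeSequence (cone G)) ≡ n + (n + sum (degreeSequence G))
sum-degree-cone {n} G = cong₂ _+_ (∣tabulate-true∣ n) (sum-tabulate-suc (degree G))

-- Dominating vertices and the exclusion of K_{p,1,1}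

-- Induction on `m`: injectivity keeps the remaining values in `s` after `f zero` is deleted.
injective⇒≤∣∣ : ∀ {n} m (s : Subset n) (f : Fin m → Fin n) → Injective _≡_ _≡_ f →
                (∀ i → f i ∈ s) → m ≤ ∣ s ∣
injective⇒≤∣∣ zero    s f inj f∈s = z≤n
injective⇒≤∣∣ (suc m) s f inj f∈s = ≤-trans
  (s≤s (injective⇒≤∣∣ m (s ∖ f zero) (f ∘ suc) (suc-injective ∘ inj)
    λ i → x∈p∧x≢y⇒x∈p-y (f∈s (suc i)) (1+i≢0 i ∘ inj)))
  (x∈p⇒∣p-x∣<∣p∣ (f∈s zero))
  where
  1+i≢0 : (i : Fin m) → suc i ≢ zero
  1+i≢0 i ()

Dominating : ∀ {m} → Graph m → Fin m → Set
Dominating H x = ∀ v → v ≢ x → T (adj H x v)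

-- `punchIn x` enumerates the vertices of `H` other than `x`; `f` sends them injectively to
-- neighbours of `f x`.
dominating⇒degree≥ : ∀ {m n} (H : Graph m) (G : Graph n) ((f , _) : H ⊑ G) x →
                     Dominating H x → m ≤ suc (degree G (f x))
dominating⇒degree≥ {suc m} H G (f , inj , hom) x dom =
  s≤s (injective⇒≤∣∣ m (neighbours G (f x)) (f ∘ punchIn x) (punchIn-injective x _ _ ∘ inj) λ i →
    lookup⇒[]= _ _ (trans (lookup∘tabulate (adj G (f x)) _)
      (Equivalence.to T-≡ (hom x (punchIn x i) (dom _ (punchInᵢ≢i x i))))))

-- The vertices `p ↑ʳ i` are the two singleton parts, so every other vertex lies in a different
-- part.
K-dominating : ∀ p (i : Fin 2) → Dominating (K p 1 1) (p ↑ʳ i)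
K-dominating p zero v v≢x rewrite splitAt-↑ʳ p 2 zero with splitAt p v in eq
... | inj₁ _          = _
... | inj₂ zero       = v≢x (sym (splitAt⁻¹-↑ʳ eq))
... | inj₂ (suc zero) = _
K-dominating p (suc zero) v v≢x rewrite splitAt-↑ʳ p 2 (suc zero) with splitAt p v in eq
... | inj₁ _          = _
... | inj₂ zero       = _
... | inj₂ (suc zero) = v≢x (sym (splitAt⁻¹-↑ʳ eq))

-- The images of both dominating vertices have degree at least p + 1, hence both equal `zero`,
-- against injectivity.
K⋢ : ∀ {n} p (G : Graph (suc n)) → (∀ v → degree G (suc v) ≤ p) → ¬ (K p 1 1 ⊑ G)
K⋢ p G deg≤ H⊑G@(f , inj , _) = hub (f x) (f y) refl refl
  where
  x = p ↑ʳ zero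
  y = p ↑ʳ suc zero

  small : ∀ i v → f (p ↑ʳ i) ≢ suc v
  small i v eq = 1+n≰n (≤-trans
    (subst (_≤ suc (degree G (suc v))) (+-comm p 2)
      (subst (λ w → p + 2 ≤ suc (degree G w)) eq
        (dominating⇒degree≥ (K p 1 1) G H⊑G (p ↑ʳ i) (K-dominating p i))))
    (s≤s (deg≤ v)))

  hub : ∀ u v → f x ≡ u → f y ≡ v → _
  hub (suc u) _       fx≡ _   = small zero u fx≡
  hub zero    (suc v) _   fy≡ = small (suc zero) v fy≡
  hub zero    zero    fx≡ fy≡ with () ← ↑ʳ-injective p _ _ (inj (trans fx≡ (sym fy≡)))

-- The bound on the threshold

-- A threshold only promises some realization containing `H`, so `H` has to be avoided by every
-- graph with the degree sequence of `G`.
threshold>sum : ∀ {m n} (H : Graph m) (G : Graph n) {l} →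
  (∀ G′ → degreeSequence G′ ≡ degreeSequence G → ¬ (H ⊑ G′)) →
  IsThreshold H n l → sum (degreeSequence G) < l
threshold>sum H G avoid (_ , thr) = ≰⇒> λ l≤sum →
  let G′ , real , H⊑G′ = thr (degreeSequence G) (G , refl) l≤sum
  in avoid G′ real H⊑G′

theorem1 : ∀ (p n : ℕ) → p ≥ 1 → n ≥ p + 2 →
    σ (K p 1 1) n ≥ 2 * (((p + 1) * (n ∸ 1) + 2) / 2)
theorem1 (suc k) (suc m) (s≤s _) (s≤s k+2≤m)
  -- Here p = k + 1 and n = m + 1: the hub uses one of the `p` edges allowed at each other vertex,
  -- leaving `k`.
  with R , row≤k , sum≥ ← nearRegular k m (subst (_≤ m) (+-comm k 2) k+2≤m)
  with thr@(divides q l≡q*2 , _) , _ ← σ-isLeast (K (suc k) 1 1) (suc m) = begin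
    2 * (((suc k + 1) * m + 2) / 2)  ≡⟨ cong (λ x → 2 * (x / 2)) (separate k m) ⟩
    2 * ((suc m * 2 + k * m) / 2)    ≡⟨ cong (2 *_) halve ⟩
    -- Evenness enters here: halving the strict inequality 2(m + h) < 2q gives m + h + 1 ≤ q, a gain
    -- of 2 in the bound.
    2 * (suc m + h)                  ≤⟨ *-monoʳ-≤ 2 (*-cancelʳ-< 2 (m + h) q sum<) ⟩
    2 * q                            ≡⟨ *-comm 2 q ⟩
    q * 2                            ≡⟨ l≡q*2 ⟨
    σ (K (suc k) 1 1) (suc m)        ∎
  where
  open ≤-Reasoning

  h : ℕ
  h = (k * m) / 2

  G : Graph m
  G = restrict R m

  separate : ∀ k m → (suc k + 1) * m + 2 ≡ suc m * 2 + k * m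
  separate = solve-∀

  halve : (suc m * 2 + k * m) / 2 ≡ suc m + h
  halve = trans (+-distrib-/-∣ˡ (k * m) (n∣m*n (suc m))) (cong (_+ h) (m*n/n≡m (suc m) 2))

  avoid : ∀ G′ → degreeSequence G′ ≡ degreeSequence (cone G) → ¬ (K (suc k) 1 1 ⊑ G′)
  avoid G′ real = K⋢ (suc k) G′ λ v → begin
    -- Degrees are compared position by position, so the hub is `zero` in every realization.
    degree G′ (suc v)                        ≡⟨ lookup∘tabulate (degree G′) (suc v) ⟨
    lookup (degreeSequence G′) (suc v)       ≡⟨ cong (λ S → lookup S (suc v)) real ⟩
    lookup (degreeSequence (cone G)) (suc v) ≡⟨ lookup∘tabulate (degree (cone G)) (suc v) ⟩
    suc (degree G v)                         ≡⟨ cong suc (degree-restrict R m v) ⟩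
    suc (rowSum R m (toℕ v))                 ≤⟨ s≤s (row≤k (toℕ v) (toℕ<n v)) ⟩
    suc k                                    ∎

  sum< : (m + h) * 2 < q * 2
  sum< = begin-strict
    (m + h) * 2                         ≡⟨ distribute m h ⟩
    m + (m + h * 2)                     ≤⟨ +-monoʳ-≤ m (+-monoʳ-≤ m sum≥) ⟩
    m + (m + ∑ m (rowSum R m))          ≡⟨ cong (λ x → m + (m + x)) (sum-degree-restrict R m) ⟨
    m + (m + sum (degreeSequence G))    ≡⟨ sum-degree-cone G ⟨
    sum (degreeSequence (cone G))       <⟨ threshold>sum (K (suc k) 1 1) (cone G) avoid thr ⟩
    σ (K (suc k) 1 1) (suc m)           ≡⟨ l≡q*2 ⟩
    q * 2                               ∎
    where
    distribute : ∀ m h → (m + h) * 2 ≡ m + (m + h * 2)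
    distribute = solve-∀
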